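{- Every finite groupoid $G$ satisfies $Q^{\mathrm{un}}_G\mathrm{FO}\subsetneq \mathrm{CFL}$.
   Context: CFL denotes the class of $\epsilon$-free context-free languages. Words over a finite ordered alphabet are viewed as finite structures with universe $\{1,\dots,n\}$, unary letter predicates $P_a$, linear order $<$, equality, constants min, max; FO is first-order logic over this signature (without BIT). Unary Lindström quantifier: for a language $L$ over ordered alphabet $(b_1,\dots,b_t)$ and formulas $\phi_1(x),\dots,\phi_{t-1}(x)$, $Q_L x[\phi_1,\dots,\phi_{t-1}]$ holds on $w$ of length $n$ iff the word of length $n$ whose $i$th letter is $b_j$ for the least $j$ with $w\models\phi_j(i)$, and $b_t$ if none, belongs to $L$. A groupoid is a finite set $G$ with an arbitrary binary operation; $\mathcal W(S,G)$, $S\subseteq G$, is the set of nonempty words over alphabet $G$ evaluating into $S$ under some legal bracketing. $Q^{\mathrm{un}}_G\mathrm{FO}$ is the class of languages definable by applying a single unary quantifier $Q_L$ with $L=\mathcal W(S,G)$ for some $S\subseteq G$ to a tuple of FO formulas. -}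

module Defs where

open import Data.Nat using (ℕ; zero; suc)
open import Data.Fin using (Fin; zero; suc; _<?_; _≟_; fromℕ)
open import Data.Bool using (Bool; true; false; _∧_; _∨_; not)
open import Data.List using (List; []; _∷_; _++_; length)
open import Data.Vec as Vec using (Vec; []; _∷_; lookup; tabulate; fromList; toList)
open import Data.Fin.Subset using (Subset; _∈_)
open import Data.Product using (Σ; _×_; _,_; ∃)
open import Data.Sum using (_⊎_; inj₁; inj₂)
open import Data.Empty using (⊥)
open import Data.List.Membership.Propositional using () renaming (_∈_ to _∈ₗ_)
open import Relation.Nullary using (¬_)
open import Relation.Nullary.Decidable using (⌊_⌋)
open import Relation.Binary.PropositionalEquality using (_≡_)
open import Function.Bundles using (_⇔_)

Lang : ℕ → Set₁
Lang k = List (Fin k) → Set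

data Term (m : ℕ) : Set where
  var : Fin m → Term m
  tmin tmax : Term m

data Fml (k : ℕ) : ℕ → Set where
  P     : ∀ {m} → Fin k → Term m → Fml k m
  _<′_  : ∀ {m} → Term m → Term m → Fml k m
  _==_  : ∀ {m} → Term m → Term m → Fml k m
  ¬′_   : ∀ {m} → Fml k m → Fml k m
  _∧′_  : ∀ {m} → Fml k m → Fml k m → Fml k m
  _∨′_  : ∀ {m} → Fml k m → Fml k m → Fml k m
  ∃′    : ∀ {m} → Fml k (suc m) → Fml k m
  ∀′    : ∀ {m} → Fml k (suc m) → Fml k m

anyFin : ∀ {n} → (Fin n → Bool) → Bool
anyFin {zero}  f = false
anyFin {suc n} f = f zero ∨ anyFin (λ i → f (suc i))

allFin : ∀ {n} → (Fin n → Bool) → Bool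
allFin {zero}  f = true
allFin {suc n} f = f zero ∧ allFin (λ i → f (suc i))

extend : ∀ {m} {X : Set} → X → (Fin m → X) → Fin (suc m) → X
extend x ρ zero    = x
extend x ρ (suc i) = ρ i

-- A word of length suc n is a structure with universe Fin (suc n)
-- (positions 0..n standing for 1..n+1), min = 0, max = n.
evalT : ∀ {m n} → (Fin m → Fin (suc n)) → Term m → Fin (suc n)
evalT ρ (var i) = ρ i
evalT ρ tmin    = zero
evalT {n = n} ρ tmax = fromℕ n

eval : ∀ {k m n} → Vec (Fin k) (suc n) → Fml k m → (Fin m → Fin (suc n)) → Bool
eval w (P a t)   ρ = ⌊ lookup w (evalT ρ t) ≟ a ⌋
eval w (s <′ t)  ρ = ⌊ evalT ρ s <? evalT ρ t ⌋
eval w (s == t)  ρ = ⌊ evalT ρ s ≟ evalT ρ t ⌋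
eval w (¬′ φ)    ρ = not (eval w φ ρ)
eval w (φ ∧′ ψ)  ρ = eval w φ ρ ∧ eval w ψ ρ
eval w (φ ∨′ ψ)  ρ = eval w φ ρ ∨ eval w ψ ρ
eval w (∃′ φ)    ρ = anyFin (λ x → eval w φ (extend x ρ))
eval w (∀′ φ)    ρ = allFin (λ x → eval w φ (extend x ρ))

-- Groupoids: a finite set, w.l.o.g. Fin (suc g) (the alphabet order
-- b_1 < ... < b_t is the order of Fin), with an arbitrary binary op.

Op : ℕ → Set
Op t = Fin t → Fin t → Fin t

data Evals {t : ℕ} (op : Op t) : List (Fin t) → Fin t → Set where
  single : ∀ a → Evals op (a ∷ []) a
  split  : ∀ {u v x y} → Evals op u x → Evals op v y → Evals op (u ++ v) (op x y)

W : ∀ {t} → Op t → Subset t → Lang t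
W op S u = Σ _ λ x → x ∈ S × Evals op u x

-- Unary Lindström quantifier Q_L x [φ_1, ..., φ_{t-1}] with t = suc g.

firstTrue : ∀ {g} → Vec Bool g → Fin (suc g)
firstTrue []           = zero
firstTrue (true ∷ bs)  = zero
firstTrue (false ∷ bs) = suc (firstTrue bs)

induced : ∀ {k g n} → Vec (Fml k 1) g → Vec (Fin k) (suc n) → List (Fin (suc g))
induced φs w = toList (tabulate (λ i → firstTrue (Vec.map (λ φ → eval w φ (λ _ → i)) φs)))

-- language defined by Q_L x [φs] (structures are nonempty words)
QLang : ∀ {k g} → Lang (suc g) → Vec (Fml k 1) g → Lang k
QLang L φs []       = ⊥
QLang L φs (a ∷ as) = L (induced φs (fromList (a ∷ as)))

InQunFO : ∀ {g} → Op (suc g) → (k : ℕ) → Lang k → Set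
InQunFO {g} op k L =
  Σ (Subset (suc g)) λ S → Σ (Vec (Fml k 1) g) λ φs →
    ∀ w → L w ⇔ QLang (W op S) φs w

record CFG (k : ℕ) : Set where
  field
    m     : ℕ
    start : Fin m
    rules : List (Fin m × List (Fin m ⊎ Fin k))

module _ {k : ℕ} (G : CFG k) where
  open CFG G
  mutual
    data Derives : (Fin m ⊎ Fin k) → List (Fin k) → Set where
      term : ∀ a → Derives (inj₂ a) (a ∷ [])
      rule : ∀ {A rhs w} → (A , rhs) ∈ₗ rules → DerivesList rhs w → Derives (inj₁ A) w

    data DerivesList : List (Fin m ⊎ Fin k) → List (Fin k) → Set where
      []  : DerivesList [] []
      _∷_ : ∀ {s ss u v} → Derives s u → DerivesList ss v → DerivesList (s ∷ ss) (u ++ v)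

Generates : ∀ {k} → CFG k → Lang k
Generates G w = Derives G (inj₁ (CFG.start G)) w

InCFL : (k : ℕ) → Lang k → Set
InCFL k L = (Σ (CFG k) λ G → ∀ w → L w ⇔ Generates G w) × ¬ L []

{-# OPTIONS --safe #-}
module Submission where

-- The truth of a first-order formula at a position of a word depends only on
-- the letter there and on the values of the prefix and the suffix in a finite
-- algebra compatible with concatenation. Hence the word induced by the formulas
-- is the output of a bimachine, and a grammar for W op S pulls back along it by
-- annotating its nonterminals with the values of a factor and of both contexts.
-- For strictness, the output letters range over a set of size t = g + 1 only:
-- over 2t letters there are (2t)ⁿ words u but only c·tⁿ pairs of values and
-- outputs, so for large n no bimachine can verify that the second half of uuᴿ
-- mirrors the first. The groupoid itself plays no role in this argument.

open import Defs
open import Data.Bool using (Bool; true; false; _∧_; _∨_; not; if_then_else_)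
open import Data.Bool.ListAction using (any)
open import Data.Bool.Properties
  using (∨-assoc; ∨-identityʳ; ∧-identityʳ; ∧-zeroʳ; ∧-distribʳ-∨)
open import Data.Fin as Fin using (Fin; zero; suc; fromℕ)
import Data.Fin.Properties as Finₚ
open import Data.Fin.Subset using (Subset; _∈_)
open import Data.Fin.Subset.Properties using (_∈?_)
open import Data.List as List using (List; []; _∷_; [_]; _++_; _∷ʳ_; null; reverse)
import Data.List.Properties as Listₚ
open import Data.List.Membership.Propositional using () renaming (_∈_ to _∈ₗ_)
open import Data.List.Membership.Propositional.Properties
  using (∈-map⁺; ∈-map⁻; ∈-++⁺ˡ; ∈-++⁺ʳ; ∈-++⁻; ∈-filter⁺; ∈-filter⁻; ∈-tabulate⁺; ∈-allFin)
open import Data.Nat using (ℕ; zero; suc; _+_; _*_; _^_; _<_; z≤n; s≤s; NonZero)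
open import Data.Nat.Properties using (suc-injective; +-identityʳ; +-mono-≤; ≤-trans; ≤-reflexive; <-trans; n<1+n;
  *-monoˡ-<; m^n>0; m^n≢0; [m*n]*[o*p]≡[m*o]*[n*p])
open import Data.Product using (Σ; _×_; _,_; proj₁; proj₂)
open import Data.Sum using (_⊎_; inj₁; inj₂; [_,_]′)
open import Data.Sum.Function.Propositional using (_⊎-↔_)
open import Data.Unit using (⊤; tt)
open import Data.Product.Function.NonDependent.Propositional using (_×-↔_)
open import Data.Vec as Vec using (Vec; []; _∷_; lookup)
import Data.Vec.Properties as Vecₚ
open import Function using (_∘_; id; _↔_; mk↔ₛ′; Inverse; _⇔_; mk⇔; Equivalence)
open import Function.Properties.Inverse using (↔-sym; ↔-trans)
open import Function.Properties.Equivalence using () renaming (trans to ⇔-trans)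
open import Relation.Nullary using (¬_; does; contradiction)
open import Relation.Nullary.Decidable using (isYes≗does)
open import Relation.Binary.PropositionalEquality hiding ([_])
open ≡-Reasoning

private variable
  A B C D : Set
  k m n : ℕ

-- Finite types

record Finite (A : Set) : Set where
  constructor finite
  field
    {size}    : ℕ
    bijection : A ↔ Fin size
  open Inverse bijection public
    using () renaming (to to enc; from to dec; strictlyInverseʳ to dec-enc; strictlyInverseˡ to enc-dec)

  elements : List A
  elements = List.tabulate dec

  ∈-elements : ∀ a → a ∈ₗ elements
  ∈-elements a = subst (_∈ₗ elements) (dec-enc a) (∈-tabulate⁺ (enc a))

Finite-Fin : Finite (Fin n)
Finite-Fin = finite (mk↔ₛ′ id id (λ _ → refl) (λ _ → refl))

Finite-Bool : Finite Bool
Finite-Bool = finite (↔-sym Finₚ.2↔Bool)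

Finite-⊤ : Finite ⊤
Finite-⊤ = finite (↔-sym Finₚ.1↔⊤)

Finite-⊎ : Finite A → Finite B → Finite (A ⊎ B)
Finite-⊎ (finite f) (finite g) = finite (↔-trans (f ⊎-↔ g) (↔-sym Finₚ.+↔⊎))

Finite-× : Finite A → Finite B → Finite (A × B)
Finite-× (finite f) (finite g) = finite (↔-trans (f ×-↔ g) (↔-sym Finₚ.*↔×))

Finite-Vec : Finite A → ∀ n → Finite (Vec A n)
Finite-Vec {A} F n = finite (Vec↔Fin n)
  where
  Vec↔Fin : ∀ n → Vec A n ↔ Fin (Finite.size F ^ n)
  Vec↔Fin zero    = mk↔ₛ′ (λ _ → zero) (λ _ → []) (λ { zero → refl }) (λ { [] → refl })
  Vec↔Fin (suc n) = ↔-trans uncons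
    (↔-trans (Finite.bijection F ×-↔ Vec↔Fin n) (↔-sym Finₚ.*↔×))
    where
    uncons : Vec A (suc n) ↔ (A × Vec A n)
    uncons = mk↔ₛ′ (λ { (x ∷ xs) → x , xs }) (λ { (x , xs) → x ∷ xs }) (λ _ → refl) (λ { (x ∷ xs) → refl })

-- Boolean quantification over positions

∨-interchange : ∀ a b c d → (a ∨ b) ∨ (c ∨ d) ≡ (a ∨ c) ∨ (b ∨ d)
∨-interchange true  b     c     d = refl
∨-interchange false true  true  d = refl
∨-interchange false true  false d = refl
∨-interchange false false c     d = refl

anyFin-cong : {f g : Fin n → Bool} → f ≗ g → anyFin f ≡ anyFin g
anyFin-cong {zero}  f≗g = refl
anyFin-cong {suc n} f≗g = cong₂ _∨_ (f≗g zero) (anyFin-cong (f≗g ∘ suc))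

anyFin-false : ∀ n → anyFin {n} (λ _ → false) ≡ false
anyFin-false zero    = refl
anyFin-false (suc n) = anyFin-false n

anyFin-∨ : (f g : Fin n → Bool) → anyFin (λ i → f i ∨ g i) ≡ anyFin f ∨ anyFin g
anyFin-∨ {zero}  f g = refl
anyFin-∨ {suc n} f g = trans (cong ((f zero ∨ g zero) ∨_) (anyFin-∨ (f ∘ suc) (g ∘ suc)))
                             (∨-interchange (f zero) (g zero) (anyFin (f ∘ suc)) (anyFin (g ∘ suc)))

anyFin-≟ : (p : Fin n) (f : Fin n → Bool) → anyFin (λ i → does (p Fin.≟ i) ∧ f i) ≡ f p
anyFin-≟ {n = suc n} zero f = trans (cong (f zero ∨_) (anyFin-false n)) (∨-identityʳ (f zero))
anyFin-≟ (suc p)          f = anyFin-≟ p (f ∘ suc)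

-- Reduces universal to existential quantification, so that closure of recognisability has to be
-- shown for one quantifier only.
allFin-not-anyFin : (f : Fin n → Bool) → not (anyFin (not ∘ f)) ≡ allFin f
allFin-not-anyFin {zero}  f = refl
allFin-not-anyFin {suc n} f with f zero
... | true  = allFin-not-anyFin (f ∘ suc)
... | false = refl

any-tabulate : (p : A → Bool) (f : Fin n → A) → any p (List.tabulate f) ≡ anyFin (p ∘ f)
any-tabulate {n = zero}  p f = refl
any-tabulate {n = suc n} p f = cong (p (f zero) ∨_) (any-tabulate p (f ∘ suc))

any-cong : {p q : A → Bool} → p ≗ q → any p ≗ any q
any-cong p≗q []       = refl
any-cong p≗q (x ∷ xs) = cong₂ _∨_ (p≗q x) (any-cong p≗q xs)

any-++ : (p : A → Bool) (xs ys : List A) → any p (xs ++ ys) ≡ any p xs ∨ any p ys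
any-++ p []       ys = refl
any-++ p (x ∷ xs) ys = trans (cong (p x ∨_) (any-++ p xs ys)) (sym (∨-assoc (p x) _ _))

any-map : (p : B → Bool) (f : A → B) → ∀ xs → any p (List.map f xs) ≡ any (p ∘ f) xs
any-map p f []       = refl
any-map p f (x ∷ xs) = cong (p (f x) ∨_) (any-map p f xs)

-- Finite sets of elements of a finite type, canonically represented by characteristic vectors

module FiniteSet (F : Finite A) where
  open Finite F

  FinSet : Set
  FinSet = Vec Bool size

  setOf : List A → FinSet
  setOf xs = Vec.tabulate λ i → any (λ x → does (enc x Fin.≟ i)) xs

  anyIn : FinSet → (A → Bool) → Bool
  anyIn X f = anyFin λ i → lookup X i ∧ f (dec i)

  -- Existential tests ignore order and multiplicity, so a list of values may be replaced by a
  -- member of the finite type `FinSet`. Each `x` contributes a single position `enc x`, where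
  -- `anyFin-≟` evaluates the test.
  anyIn-setOf : ∀ xs f → anyIn (setOf xs) f ≡ any f xs
  anyIn-setOf xs f = trans (anyFin-cong λ i → cong (_∧ f (dec i)) (Vecₚ.lookup∘tabulate _ i)) (go xs)
    where
    among : List A → Fin size → Bool
    among xs i = any (λ x → does (enc x Fin.≟ i)) xs

    go : ∀ xs → anyFin (λ i → among xs i ∧ f (dec i)) ≡ any f xs
    go []       = anyFin-false size
    go (x ∷ xs) = begin
      anyFin (λ i → among (x ∷ xs) i ∧ f (dec i))
        ≡⟨ anyFin-cong (λ i → ∧-distribʳ-∨ (f (dec i)) (does (enc x Fin.≟ i)) (among xs i)) ⟩
      anyFin (λ i → does (enc x Fin.≟ i) ∧ f (dec i) ∨ among xs i ∧ f (dec i))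
        ≡⟨ anyFin-∨ (λ i → does (enc x Fin.≟ i) ∧ f (dec i)) (λ i → among xs i ∧ f (dec i)) ⟩
      anyFin (λ i → does (enc x Fin.≟ i) ∧ f (dec i)) ∨ anyFin (λ i → among xs i ∧ f (dec i))
        ≡⟨ cong₂ _∨_ (trans (anyFin-≟ (enc x) (f ∘ dec)) (cong f (dec-enc x))) (go xs) ⟩
      f x ∨ any f xs ∎

-- Recognition by finite algebras

-- No associativity is required: on the image of ⟦_⟧ it follows from ⟦⟧-++.
record Morphism (A : Set) : Set₁ where
  infixl 7 _·_
  field
    {Carrier}       : Set
    Carrier-finite  : Finite Carrier
    ⟦_⟧             : List A → Carrier
    _·_             : Carrier → Carrier → Carrier
    ⟦⟧-++           : ∀ u v → ⟦ u ++ v ⟧ ≡ ⟦ u ⟧ · ⟦ v ⟧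

record Recognisable {A B : Set} (f : List A → B) : Set₁ where
  field
    morphism : Morphism A
  open Morphism morphism public
  field
    accept     : Carrier → B
    recognises : ∀ u → f u ≡ accept ⟦ u ⟧

Recognisable-const : (b : B) → Recognisable {A} (λ _ → b)
Recognisable-const b = record
  { morphism   = record { Carrier-finite = Finite-⊤ ; ⟦_⟧ = λ _ → tt ; _·_ = λ _ _ → tt ; ⟦⟧-++ = λ _ _ → refl }
  ; accept     = λ _ → b
  ; recognises = λ _ → refl
  }

Recognisable-map : (h : B → C) {f : List A → B} → Recognisable f → Recognisable (h ∘ f)
Recognisable-map h F = record
  { morphism = morphism ; accept = h ∘ accept ; recognises = λ u → cong h (recognises u) }
  where open Recognisable F

Recognisable-zip : (h : B → C → D) {f : List A → B} {g : List A → C} →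
  Recognisable f → Recognisable g → Recognisable (λ u → h (f u) (g u))
Recognisable-zip h F G = record
  { morphism = record
    { Carrier-finite = Finite-× F.Carrier-finite G.Carrier-finite
    ; ⟦_⟧   = λ u → F.⟦ u ⟧ , G.⟦ u ⟧
    ; _·_   = λ (a , b) (c , d) → a F.· c , b G.· d
    ; ⟦⟧-++ = λ u v → cong₂ _,_ (F.⟦⟧-++ u v) (G.⟦⟧-++ u v)
    }
  ; accept     = λ (a , b) → h (F.accept a) (G.accept b)
  ; recognises = λ u → cong₂ h (F.recognises u) (G.recognises u)
  }
  where module F = Recognisable F
        module G = Recognisable G

Recognisable-any : (p : A → Bool) → Recognisable (any p)
Recognisable-any p = record
  { morphism   = record { Carrier-finite = Finite-Bool ; ⟦_⟧ = any p ; _·_ = _∨_ ; ⟦⟧-++ = any-++ p }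
  ; accept     = λ b → b
  ; recognises = λ _ → refl
  }

before : (p q : A → Bool) → List A → Bool
before p q []      = false
before p q (x ∷ u) = p x ∧ any q u ∨ before p q u

-- A pair of positions lies inside `u`, inside `v`, or straddles the cut. The straddling pairs are
-- why the recognising algebra also records `any p` and `any q`.
before-++ : (p q : A → Bool) → ∀ u v →
  before p q (u ++ v) ≡ (before p q u ∨ any p u ∧ any q v) ∨ before p q v
before-++ p q []      v = refl
before-++ p q (x ∷ u) v = trans
  (cong₂ (λ a b → p x ∧ a ∨ b) (any-++ q u v) (before-++ p q u v))
  (shuffle (p x) (any q u) (any q v) (before p q u) (any p u) (before p q v))
  where
  shuffle : ∀ a b c d e f → a ∧ (b ∨ c) ∨ ((d ∨ e ∧ c) ∨ f) ≡ ((a ∧ b ∨ d) ∨ (a ∨ e) ∧ c) ∨ f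
  shuffle false b     c     d     e f = refl
  shuffle true  true  c     d     e f = refl
  shuffle true  false true  true  e f = refl
  shuffle true  false true  false e f = refl
  shuffle true  false false true  e f = refl
  shuffle true  false false false true  f = refl
  shuffle true  false false false false f = refl

Recognisable-before : (p q : A → Bool) → Recognisable (before p q)
Recognisable-before p q = record
  { morphism = record
    { Carrier-finite = Finite-× Finite-Bool (Finite-× Finite-Bool Finite-Bool)
    ; ⟦_⟧   = λ u → before p q u , any p u , any q u
    ; _·_   = λ (b , x , y) (b′ , x′ , y′) → (b ∨ x ∧ y′) ∨ b′ , x ∨ x′ , y ∨ y′
    ; ⟦⟧-++ = λ u v → cong₂ _,_ (before-++ p q u v) (cong₂ _,_ (any-++ p u v) (any-++ q u v))
    }
  ; accept     = proj₁
  ; recognises = λ _ → refl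
  }

-- Words with marked positions

-- An assignment of `m` variables is stored in the word itself, one bit per variable at each
-- position; `isFirst` and `isLast` do the same for the constants min and max.
record Letter (k m : ℕ) : Set where
  constructor letter
  field
    symbol  : Fin k
    isFirst : Bool
    isLast  : Bool
    marks   : Vec Bool m
open Letter

put : Bool → Letter k m → Letter k (suc m)
put b (letter a l r V) = letter a l r (b ∷ V)

unmarked : List (Letter k m) → List (Letter k (suc m))
unmarked = List.map (put false)

markings : List (Letter k m) → List (List (Letter k (suc m)))
markings []      = []
markings (x ∷ u) = (put true x ∷ unmarked u) ∷ List.map (put false x ∷_) (markings u)

-- The new mark falls either in `u` or in `v`. This is the source of the product in the algebra for
-- a quantified formula.
markings-++ : (u v : List (Letter k m)) →
  markings (u ++ v) ≡ List.map (_++ unmarked v) (markings u) ++ List.map (unmarked u ++_) (markings v)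
markings-++ []      v = sym (Listₚ.map-id (markings v))
markings-++ (x ∷ u) v = cong₂ _∷_ (cong (put true x ∷_) (Listₚ.map-++ _ u v)) (begin
  List.map (put false x ∷_) (markings (u ++ v))
    ≡⟨ cong (List.map _) (markings-++ u v) ⟩
  List.map (put false x ∷_) (List.map (_++ unmarked v) (markings u) ++ List.map (unmarked u ++_) (markings v))
    ≡⟨ Listₚ.map-++ _ (List.map (_++ unmarked v) (markings u)) _ ⟩
  List.map (put false x ∷_) (List.map (_++ unmarked v) (markings u))
    ++ List.map (put false x ∷_) (List.map (unmarked u ++_) (markings v))
    ≡⟨ cong₂ _++_ (trans (sym (Listₚ.map-∘ (markings u))) (Listₚ.map-∘ (markings u))) (sym (Listₚ.map-∘ (markings v))) ⟩
  List.map (_++ unmarked v) (List.map (put false x ∷_) (markings u))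
    ++ List.map (unmarked (x ∷ u) ++_) (markings v) ∎)

-- For `f = markedLetter w ρ` the inner lists are, by computation, the words `mark w (extend i ρ)`:
-- placing a mark is extending an assignment.
markings-tabulate : (f : Fin n → Letter k m) →
  markings (List.tabulate f) ≡ List.tabulate λ i → List.tabulate λ j → put (does (i Fin.≟ j)) (f j)
markings-tabulate {zero}  f = refl
markings-tabulate {suc n} f = cong₂ _∷_
  (cong (_ ∷_) (Listₚ.map-tabulate (f ∘ suc) (put false)))
  (trans (cong (List.map _) (markings-tabulate (f ∘ suc))) (Listₚ.map-tabulate _ (put false (f zero) ∷_)))

-- Under the quantifier, a factor u acts through its value without the new
-- mark together with the set of its values over all placements of the mark.
Recognisable-markings : {f : List (Letter k (suc m)) → Bool} →
  Recognisable f → Recognisable (any f ∘ markings)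
Recognisable-markings {f = f} F = record
  { morphism = record
    { Carrier-finite = Finite-× Carrier-finite (Finite-Vec Finite-Bool _)
    ; ⟦_⟧   = λ u → ⟦ unmarked u ⟧ , setOf (List.map ⟦_⟧ (markings u))
    ; _·_   = λ (a , X) (b , Y) → a · b , Vec.tabulate λ i →
                anyIn X (λ c → does (enc (c · b) Fin.≟ i)) ∨ anyIn Y (λ c → does (enc (a · c) Fin.≟ i))
    ; ⟦⟧-++ = λ u v → cong₂ _,_
                (trans (cong ⟦_⟧ (Listₚ.map-++ _ u v)) (⟦⟧-++ _ _))
                (Vecₚ.tabulate-cong λ i → values-++ (λ c → does (enc c Fin.≟ i)) u v)
    }
  ; accept     = λ (a , X) → anyIn X accept
  ; recognises = λ u → begin
      any f (markings u)                                ≡⟨ any-cong recognises (markings u) ⟩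
      any (accept ∘ ⟦_⟧) (markings u)                   ≡⟨ any-map accept ⟦_⟧ (markings u) ⟨
      any accept (values u)                             ≡⟨ anyIn-setOf (values u) accept ⟨
      anyIn (setOf (values u)) accept                   ∎
  }
  where
  open Recognisable F
  open Finite Carrier-finite
  open FiniteSet Carrier-finite

  values : List (Letter _ _) → List Carrier
  values u = List.map ⟦_⟧ (markings u)

  -- Kept general in `p`: the tests for equality with each single value yield the characteristic
  -- vector of the product.
  values-++ : ∀ p u v → any p (values (u ++ v)) ≡
    anyIn (setOf (values u)) (λ c → p (c · ⟦ unmarked v ⟧)) ∨ anyIn (setOf (values v)) (λ c → p (⟦ unmarked u ⟧ · c))
  values-++ p u v = begin
    any p (values (u ++ v))
      ≡⟨ any-map p ⟦_⟧ (markings (u ++ v)) ⟩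
    any (p ∘ ⟦_⟧) (markings (u ++ v))
      ≡⟨ cong (any _) (markings-++ u v) ⟩
    any (p ∘ ⟦_⟧) (List.map (_++ unmarked v) (markings u) ++ List.map (unmarked u ++_) (markings v))
      ≡⟨ any-++ _ (List.map (_++ unmarked v) (markings u)) _ ⟩
    any (p ∘ ⟦_⟧) (List.map (_++ unmarked v) (markings u)) ∨ any (p ∘ ⟦_⟧) (List.map (unmarked u ++_) (markings v))
      ≡⟨ cong₂ _∨_ (move (_++ unmarked v) (_· ⟦ unmarked v ⟧) (λ w → ⟦⟧-++ w _) u)
                   (move (unmarked u ++_) (⟦ unmarked u ⟧ ·_) (⟦⟧-++ _) v) ⟩
    anyIn (setOf (values u)) (λ c → p (c · ⟦ unmarked v ⟧)) ∨ anyIn (setOf (values v)) (λ c → p (⟦ unmarked u ⟧ · c)) ∎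
    where
    move : ∀ (s : List (Letter _ _) → List (Letter _ _)) (t : Carrier → Carrier) → (∀ w → ⟦ s w ⟧ ≡ t ⟦ w ⟧) → ∀ u →
      any (p ∘ ⟦_⟧) (List.map s (markings u)) ≡ anyIn (setOf (values u)) (p ∘ t)
    move s t eq u = begin
      any (p ∘ ⟦_⟧) (List.map s (markings u))   ≡⟨ any-map _ s (markings u) ⟩
      any (p ∘ ⟦_⟧ ∘ s) (markings u)            ≡⟨ any-cong (cong p ∘ eq) (markings u) ⟩
      any (p ∘ t ∘ ⟦_⟧) (markings u)            ≡⟨ any-map (p ∘ t) ⟦_⟧ (markings u) ⟨
      any (p ∘ t) (values u)                    ≡⟨ anyIn-setOf (values u) (p ∘ t) ⟨
      anyIn (setOf (values u)) (p ∘ t)          ∎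

-- First-order formulas on marked words

carries : Term m → Letter k m → Bool
carries (var i) x = lookup (marks x) i
carries tmin    x = isFirst x
carries tmax    x = isLast x

-- A semantics on all marked words, as recognition by an algebra requires. It is compared with
-- `eval` only on words `mark w ρ`, where each variable and each constant sits at exactly one
-- position.
holds : Fml k m → List (Letter k m) → Bool
holds (P a t)  u = any (λ x → carries t x ∧ does (symbol x Fin.≟ a)) u
holds (s <′ t) u = before (carries s) (carries t) u
holds (s == t) u = any (λ x → carries t x ∧ carries s x) u
holds (¬′ φ)   u = not (holds φ u)
holds (φ ∧′ ψ) u = holds φ u ∧ holds ψ u
holds (φ ∨′ ψ) u = holds φ u ∨ holds ψ u
holds (∃′ φ)   u = any (holds φ) (markings u)
holds (∀′ φ)   u = not (any (not ∘ holds φ) (markings u))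

holds-recognisable : (φ : Fml k m) → Recognisable (holds φ)
holds-recognisable (P a t)  = Recognisable-any _
holds-recognisable (s <′ t) = Recognisable-before _ _
holds-recognisable (s == t) = Recognisable-any _
holds-recognisable (¬′ φ)   = Recognisable-map not (holds-recognisable φ)
holds-recognisable (φ ∧′ ψ) = Recognisable-zip _∧_ (holds-recognisable φ) (holds-recognisable ψ)
holds-recognisable (φ ∨′ ψ) = Recognisable-zip _∨_ (holds-recognisable φ) (holds-recognisable ψ)
holds-recognisable (∃′ φ)   = Recognisable-markings (holds-recognisable φ)
holds-recognisable (∀′ φ)   = Recognisable-map not (Recognisable-markings (Recognisable-map not (holds-recognisable φ)))

markedLetter : Vec (Fin k) (suc n) → (Fin m → Fin (suc n)) → Fin (suc n) → Letter k m
markedLetter {n = n} w ρ j =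
  letter (lookup w j) (does (zero Fin.≟ j)) (does (fromℕ n Fin.≟ j)) (Vec.tabulate λ x → does (ρ x Fin.≟ j))

mark : Vec (Fin k) (suc n) → (Fin m → Fin (suc n)) → List (Letter k m)
mark w ρ = List.tabulate (markedLetter w ρ)

any-tabulate-none : (p : A → Bool) (f : Fin m → A) → (∀ j → p (f j) ≡ false) → any p (List.tabulate f) ≡ false
any-tabulate-none {m = m} p f pf = trans (any-tabulate p f) (trans (anyFin-cong pf) (anyFin-false m))

any-tabulate-some : (p : A → Bool) (f : Fin m → A) (b : Fin m) → (∀ j → p (f j) ≡ does (b Fin.≟ j)) → any p (List.tabulate f) ≡ true
any-tabulate-some p f zero    pf rewrite pf zero = refl
any-tabulate-some p f (suc b) pf rewrite pf zero = any-tabulate-some p (f ∘ suc) b (pf ∘ suc)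

before-tabulate-noneˡ : (p q : A → Bool) (f : Fin m → A) → (∀ j → p (f j) ≡ false) → before p q (List.tabulate f) ≡ false
before-tabulate-noneˡ {m = zero}  p q f pf = refl
before-tabulate-noneˡ {m = suc m} p q f pf rewrite pf zero = before-tabulate-noneˡ p q (f ∘ suc) (pf ∘ suc)

before-tabulate-noneʳ : (p q : A → Bool) (f : Fin m → A) → (∀ j → q (f j) ≡ false) → before p q (List.tabulate f) ≡ false
before-tabulate-noneʳ {m = zero}  p q f qf = refl
before-tabulate-noneʳ {m = suc m} p q f qf rewrite any-tabulate-none q (f ∘ suc) (qf ∘ suc) with p (f zero)
... | true  = before-tabulate-noneʳ p q (f ∘ suc) (qf ∘ suc)
... | false = before-tabulate-noneʳ p q (f ∘ suc) (qf ∘ suc)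

before-tabulate : (p q : A → Bool) (f : Fin m → A) (a b : Fin m) →
  (∀ j → p (f j) ≡ does (a Fin.≟ j)) → (∀ j → q (f j) ≡ does (b Fin.≟ j)) →
  before p q (List.tabulate f) ≡ does (a Fin.<? b)
before-tabulate p q f zero    zero    pf qf rewrite pf zero | any-tabulate-none q (f ∘ suc) (qf ∘ suc) = before-tabulate-noneˡ p q (f ∘ suc) (pf ∘ suc)
before-tabulate p q f zero    (suc b) pf qf rewrite pf zero | any-tabulate-some q (f ∘ suc) b (qf ∘ suc) = refl
before-tabulate p q f (suc a) zero    pf qf rewrite pf zero = before-tabulate-noneʳ p q (f ∘ suc) (qf ∘ suc)
before-tabulate p q f (suc a) (suc b) pf qf rewrite pf zero = before-tabulate p q (f ∘ suc) a b (pf ∘ suc) (qf ∘ suc)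

module _ (w : Vec (Fin k) (suc n)) where

  carries-mark : (ρ : Fin m → Fin (suc n)) (t : Term m) (j : Fin (suc n)) →
    carries t (markedLetter w ρ j) ≡ does (evalT ρ t Fin.≟ j)
  carries-mark ρ (var i) j = Vecₚ.lookup∘tabulate (λ x → does (ρ x Fin.≟ j)) i
  carries-mark ρ tmin    j = refl
  carries-mark ρ tmax    j = refl

  -- Exactly one letter of `mark w ρ` carries `t`, so searching for such a letter amounts to
  -- evaluating at the position of `t`.
  any-carries : (ρ : Fin m → Fin (suc n)) (t : Term m) (p : Letter k m → Bool) (b : Fin (suc n) → Bool) →
    (∀ j → p (markedLetter w ρ j) ≡ b j) →
    any (λ x → carries t x ∧ p x) (mark w ρ) ≡ b (evalT ρ t)
  any-carries ρ t p b eq = begin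
    any (λ x → carries t x ∧ p x) (mark w ρ)
      ≡⟨ any-tabulate (λ x → carries t x ∧ p x) (markedLetter w ρ) ⟩
    anyFin (λ j → carries t (markedLetter w ρ j) ∧ p (markedLetter w ρ j))
      ≡⟨ anyFin-cong (λ j → cong₂ _∧_ (carries-mark ρ t j) (eq j)) ⟩
    anyFin (λ j → does (evalT ρ t Fin.≟ j) ∧ b j)
      ≡⟨ anyFin-≟ (evalT ρ t) b ⟩
    b (evalT ρ t) ∎

  any-markings : (ρ : Fin m → Fin (suc n)) (p : List (Letter k (suc m)) → Bool) (b : Fin (suc n) → Bool) →
    (∀ i → p (mark w (extend i ρ)) ≡ b i) → any p (markings (mark w ρ)) ≡ anyFin b
  any-markings ρ p b eq = begin
    any p (markings (mark w ρ))                         ≡⟨ cong (any p) (markings-tabulate (markedLetter w ρ)) ⟩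
    any p (List.tabulate λ i → mark w (extend i ρ))     ≡⟨ any-tabulate p (λ i → mark w (extend i ρ)) ⟩
    anyFin (λ i → p (mark w (extend i ρ)))              ≡⟨ anyFin-cong eq ⟩
    anyFin b                                            ∎

  holds-mark : (φ : Fml k m) (ρ : Fin m → Fin (suc n)) → holds φ (mark w ρ) ≡ eval w φ ρ
  holds-mark (P a t)  ρ = trans
    (any-carries ρ t (λ x → does (symbol x Fin.≟ a)) (λ j → does (lookup w j Fin.≟ a)) λ _ → refl)
    (sym (isYes≗does (lookup w (evalT ρ t) Fin.≟ a)))
  holds-mark (s <′ t) ρ = trans
    (before-tabulate (carries s) (carries t) (markedLetter w ρ) (evalT ρ s) (evalT ρ t) (carries-mark ρ s) (carries-mark ρ t))
    (sym (isYes≗does (evalT ρ s Fin.<? evalT ρ t)))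
  holds-mark (s == t) ρ = trans
    (any-carries ρ t (carries s) (λ j → does (evalT ρ s Fin.≟ j)) (carries-mark ρ s))
    (sym (isYes≗does (evalT ρ s Fin.≟ evalT ρ t)))
  holds-mark (¬′ φ)   ρ = cong not (holds-mark φ ρ)
  holds-mark (φ ∧′ ψ) ρ = cong₂ _∧_ (holds-mark φ ρ) (holds-mark ψ ρ)
  holds-mark (φ ∨′ ψ) ρ = cong₂ _∨_ (holds-mark φ ρ) (holds-mark ψ ρ)
  holds-mark (∃′ φ)   ρ = any-markings ρ (holds φ) (λ i → eval w φ (extend i ρ)) λ i → holds-mark φ (extend i ρ)
  holds-mark (∀′ φ)   ρ = trans
    (cong not (any-markings ρ (not ∘ holds φ) (λ i → not (eval w φ (extend i ρ))) λ i → cong not (holds-mark φ (extend i ρ))))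
    (allFin-not-anyFin λ i → eval w φ (extend i ρ))

-- From formulas to bimachines

-- `l` and `r` say whether the factor starts and ends the whole word, so that the flags for min and
-- max can be assigned factor by factor.
flag : (l r : Bool) → List (Fin k) → List (Letter k 0)
flag l r []      = []
flag l r (a ∷ u) = letter a l (r ∧ null u) [] ∷ flag false r u

flag-++ : ∀ l r (u v : List (Fin k)) → flag l r (u ++ v) ≡ flag l (r ∧ null v) u ++ flag (l ∧ null u) r v
flag-++ l r []      v = cong (λ l → flag l r v) (sym (∧-identityʳ l))
flag-++ l r (a ∷ u) v = cong₂ _∷_
  (cong (λ b → letter a l b []) (null-∧ u))
  (trans (flag-++ false r u v) (cong (λ l → _ ++ flag l r v) (sym (∧-zeroʳ l))))
  where
  null-∧ : ∀ u → r ∧ null (u ++ v) ≡ (r ∧ null v) ∧ null u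
  null-∧ []      = sym (∧-identityʳ _)
  null-∧ (_ ∷ _) = trans (∧-zeroʳ r) (sym (∧-zeroʳ _))

mark-flag : (w : Vec (Fin k) (suc n)) → mark w (λ ()) ≡ flag true true (Vec.toList w)
-- `l` is generalised because after the first letter no position is the minimum any more.
mark-flag = go true
  where
  go : ∀ l (w : Vec (Fin k) (suc n)) →
    List.tabulate (λ j → letter (lookup w j) (l ∧ does (zero Fin.≟ j)) (does (fromℕ n Fin.≟ j)) [])
      ≡ flag l true (Vec.toList w)
  go l (a ∷ [])    = cong (λ b → letter a b true [] ∷ []) (∧-identityʳ l)
  go l (a ∷ b ∷ w) = cong₂ _∷_
    (cong (λ l → letter a l false []) (∧-identityʳ l))
    (trans (Listₚ.tabulate-cong λ j → cong (λ l → letter (lookup (b ∷ w) j) l (does (fromℕ _ Fin.≟ j)) []) (∧-zeroʳ l))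
           (go false (b ∷ w)))

-- A function of two Booleans as a tuple of its values: pointwise equality then gives equality, and
-- finiteness is that of a product.
Table : Set → Set
Table A = (A × A) × (A × A)

table : (Bool → Bool → A) → Table A
table f = (f true true , f true false) , (f false true , f false false)

at : Table A → Bool → Bool → A
at ((a , b) , (c , d)) l r = if l then (if r then a else b) else (if r then c else d)

at-table : (f : Bool → Bool → A) → ∀ l r → at (table f) l r ≡ f l r
at-table f true  true  = refl
at-table f true  false = refl
at-table f false true  = refl
at-table f false false = refl

table-cong : {f g : Bool → Bool → A} → (∀ l r → f l r ≡ g l r) → table f ≡ table g
table-cong eq = cong₂ _,_ (cong₂ _,_ (eq true true) (eq true false)) (cong₂ _,_ (eq false true) (eq false false))

record Bimachine (k t : ℕ) : Set₁ where
  field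
    morphism : Morphism (Fin k)
  open Morphism morphism public
  field
    out : Carrier → Fin k → Carrier → Fin t

  -- The output produced on the factor w of p w q.
  run : (p w q : List (Fin k)) → List (Fin t)
  run p []      q = []
  run p (a ∷ w) q = out ⟦ p ⟧ a ⟦ w ++ q ⟧ ∷ run (p ∷ʳ a) w q

-- A factor does not know whether it touches the ends of the word. Its value therefore lists the
-- values under all four choices of boundary flags, together with its emptiness, which decides the
-- flags of its neighbour in a product.
bimachine : ∀ {t} {f : List (Letter k 1) → Fin t} → Recognisable f → Bimachine k t
bimachine F = record
  { morphism = record
    { Carrier-finite = Finite-× Finite-Bool
        (Finite-× (Finite-× Carrier-finite Carrier-finite) (Finite-× Carrier-finite Carrier-finite))
    ; ⟦_⟧   = λ u → null u , table λ l r → ⟦ unmarked (flag l r u) ⟧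
    ; _·_   = λ (m , X) (n , Y) → m ∧ n , table λ l r → at X l (r ∧ n) · at Y (l ∧ m) r
    ; ⟦⟧-++ = λ u v → cong₂ _,_ (null-++ u v) (table-cong λ l r → begin
        ⟦ unmarked (flag l r (u ++ v)) ⟧
          ≡⟨ cong (⟦_⟧ ∘ unmarked) (flag-++ l r u v) ⟩
        ⟦ unmarked (flag l (r ∧ null v) u ++ flag (l ∧ null u) r v) ⟧
          ≡⟨ cong ⟦_⟧ (Listₚ.map-++ _ (flag l (r ∧ null v) u) _) ⟩
        ⟦ unmarked (flag l (r ∧ null v) u) ++ unmarked (flag (l ∧ null u) r v) ⟧
          ≡⟨ ⟦⟧-++ _ _ ⟩
        ⟦ unmarked (flag l (r ∧ null v) u) ⟧ · ⟦ unmarked (flag (l ∧ null u) r v) ⟧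
          ≡⟨ cong₂ _·_ (at-table (λ l r → ⟦ unmarked (flag l r u) ⟧) l (r ∧ null v))
                       (at-table (λ l r → ⟦ unmarked (flag l r v) ⟧) (l ∧ null u) r) ⟨
        _ ∎)
    }
  -- The prefix may start the word but cannot end it, dually for the suffix; the marked letter is
  -- first if the prefix is empty and last if the suffix is.
  ; out = λ (m , X) a (n , Y) → accept (at X true false · (⟦ [ letter a m n (true ∷ []) ] ⟧ · at Y false true))
  }
  where
  open Recognisable F
  null-++ : (u v : List A) → null (u ++ v) ≡ null u ∧ null v
  null-++ []      v = refl
  null-++ (_ ∷ _) v = refl

run-bimachine : ∀ {t} {f : List (Letter k 1) → Fin t} (F : Recognisable f) (w : List (Fin k)) →
  Bimachine.run (bimachine F) [] w [] ≡ List.map f (markings (flag true true w))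
run-bimachine {k = k} {f = f} F = go []
  where
  open Recognisable F
  module B = Bimachine (bimachine F)

  context : List (Fin k) → List (Fin k) → List (Letter k 1)
  context p w = unmarked (flag true (null w) p)

  context-∷ʳ : ∀ p a w → context (p ∷ʳ a) w ≡ context p (a ∷ w) ++ [ letter a (null p) (null w) (false ∷ []) ]
  context-∷ʳ p a w = begin
    unmarked (flag true (null w) (p ∷ʳ a))
      ≡⟨ cong unmarked (flag-++ true (null w) p [ a ]) ⟩
    unmarked (flag true (null w ∧ false) p ++ [ letter a (null p) (null w ∧ true) [] ])
      ≡⟨ cong₂ (λ b c → unmarked (flag true b p ++ [ letter a (null p) c [] ])) (∧-zeroʳ (null w)) (∧-identityʳ (null w)) ⟩
    unmarked (flag true false p ++ [ letter a (null p) (null w) [] ])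
      ≡⟨ Listₚ.map-++ (put false) (flag true false p) _ ⟩
    context p (a ∷ w) ++ [ letter a (null p) (null w) (false ∷ []) ] ∎

  null-∷ʳ : ∀ (p : List A) a → null (p ∷ʳ a) ≡ false
  null-∷ʳ []      a = refl
  null-∷ʳ (_ ∷ _) a = refl

  -- The letters already read are kept unmarked in `context p w`; the induction runs through the
  -- placements of the mark in the rest `w`.
  go : ∀ p w → B.run p w [] ≡ List.map (λ z → f (context p w ++ z)) (markings (flag (null p) true w))
  go p []      = refl
  go p (a ∷ w) = cong₂ _∷_ (trans (cong (λ v → B.out B.⟦ p ⟧ a B.⟦ v ⟧) (Listₚ.++-identityʳ w)) hd) tl
    where
    hd : B.out B.⟦ p ⟧ a B.⟦ w ⟧ ≡ f (context p (a ∷ w) ++ (letter a (null p) (null w) (true ∷ []) ∷ unmarked (flag false true w)))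
    hd = sym (trans (recognises _) (cong accept
      (trans (⟦⟧-++ (context p (a ∷ w)) _) (cong (⟦ context p (a ∷ w) ⟧ ·_) (⟦⟧-++ [ _ ] _)))))

    tl : B.run (p ∷ʳ a) w [] ≡ List.map (λ z → f (context p (a ∷ w) ++ z))
      (List.map (letter a (null p) (null w) (false ∷ []) ∷_) (markings (flag false true w)))
    tl = begin
      B.run (p ∷ʳ a) w []
        ≡⟨ go (p ∷ʳ a) w ⟩
      List.map (λ z → f (context (p ∷ʳ a) w ++ z)) (markings (flag (null (p ∷ʳ a)) true w))
        ≡⟨ cong₂ (λ c b → List.map (λ z → f (c ++ z)) (markings (flag b true w))) (context-∷ʳ p a w) (null-∷ʳ p a) ⟩
      List.map (λ z → f ((context p (a ∷ w) ++ [ letter a (null p) (null w) (false ∷ []) ]) ++ z)) (markings (flag false true w))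
        ≡⟨ Listₚ.map-cong (λ z → cong f (Listₚ.++-assoc (context p (a ∷ w)) _ z)) _ ⟩
      List.map (λ z → f (context p (a ∷ w) ++ (letter a (null p) (null w) (false ∷ []) ∷ z))) (markings (flag false true w))
        ≡⟨ Listₚ.map-∘ (markings (flag false true w)) ⟩
      _ ∎

holds-all-recognisable : ∀ {g} (φs : Vec (Fml k m) g) → Recognisable (λ u → Vec.map (λ φ → holds φ u) φs)
holds-all-recognisable []       = Recognisable-const []
holds-all-recognisable (φ ∷ φs) = Recognisable-zip _∷_ (holds-recognisable φ) (holds-all-recognisable φs)

induced-bimachine : ∀ {g} → Vec (Fml k 1) g → Bimachine k (suc g)
induced-bimachine φs = bimachine (Recognisable-map firstTrue (holds-all-recognisable φs))

run-induced : ∀ {g} (φs : Vec (Fml k 1) g) (w : Vec (Fin k) (suc n)) →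
  induced φs w ≡ Bimachine.run (induced-bimachine φs) [] (Vec.toList w) []
run-induced {k = k} φs w = begin
  Vec.toList (Vec.tabulate λ i → firstTrue (Vec.map (λ φ → eval w φ (λ _ → i)) φs))
    ≡⟨ toList-tabulate (λ i → firstTrue (Vec.map (λ φ → eval w φ (λ _ → i)) φs)) ⟩
  List.tabulate (λ i → firstTrue (Vec.map (λ φ → eval w φ (λ _ → i)) φs))
    ≡⟨ Listₚ.tabulate-cong (λ i → cong firstTrue (Vecₚ.map-cong (λ φ → holds-mark w φ (λ _ → i)) φs)) ⟨
  List.tabulate (λ i → f (mark w (λ _ → i)))
    ≡⟨ Listₚ.map-tabulate (λ i → mark w (λ _ → i)) f ⟨
  List.map f (List.tabulate λ i → mark w (λ _ → i))
    -- The assignments of the single free variable are the placements of one mark in the word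
    -- without marks.
    ≡⟨ cong (List.map f) (markings-tabulate (markedLetter w (λ ()))) ⟨
  List.map f (markings (mark w (λ ())))
    ≡⟨ cong (List.map f ∘ markings) (mark-flag w) ⟩
  List.map f (markings (flag true true (Vec.toList w)))
    ≡⟨ run-bimachine (Recognisable-map firstTrue (holds-all-recognisable φs)) (Vec.toList w) ⟨
  Bimachine.run (induced-bimachine φs) [] (Vec.toList w) [] ∎
  where
  f : List (Letter k 1) → Fin _
  f u = firstTrue (Vec.map (λ φ → holds φ u) φs)
  toList-tabulate : (h : Fin m → A) → Vec.toList (Vec.tabulate h) ≡ List.tabulate h
  toList-tabulate {m = zero}  h = refl
  toList-tabulate {m = suc m} h = cong (h zero ∷_) (toList-tabulate (h ∘ suc))

-- Runs of a bimachine on factors in context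

module BimachineProperties {t : ℕ} (B : Bimachine k t) where
  open Bimachine B

  -- `out` sees the contexts only through their values, and by `⟦⟧-++` the values stay equal when
  -- letters of `w` are added to them.
  run-cong : ∀ {p p′ q q′} w → ⟦ p ⟧ ≡ ⟦ p′ ⟧ → ⟦ q ⟧ ≡ ⟦ q′ ⟧ → run p w q ≡ run p′ w q′
  run-cong []      p≡ q≡ = refl
  run-cong (a ∷ w) p≡ q≡ = cong₂ _∷_
    (cong₂ (λ x y → out x a y) p≡ (trans (⟦⟧-++ w _) (trans (cong (⟦ w ⟧ ·_) q≡) (sym (⟦⟧-++ w _)))))
    (run-cong w (trans (⟦⟧-++ _ [ a ]) (trans (cong (_· ⟦ [ a ] ⟧) p≡) (sym (⟦⟧-++ _ [ a ])))) q≡)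

  run-++ : ∀ p u v q → run p (u ++ v) q ≡ run p u (v ++ q) ++ run (p ++ u) v q
  run-++ p []      v q = cong (λ p → run p v q) (sym (Listₚ.++-identityʳ p))
  run-++ p (a ∷ u) v q = cong₂ _∷_
    (cong (λ z → out ⟦ p ⟧ a ⟦ z ⟧) (Listₚ.++-assoc u v q))
    (trans (run-++ (p ∷ʳ a) u v q) (cong (λ p′ → run (p ∷ʳ a) u (v ++ q) ++ run p′ v q) (Listₚ.++-assoc p [ a ] u)))

  -- A run emits one letter per letter read, so every cut of the output comes from a cut of the
  -- input. This transfers a bracketing of the output to the input word.
  run-split : ∀ y z p w q → y ++ z ≡ run p w q →
    Σ (List (Fin k)) λ u → Σ (List (Fin k)) λ v →
      w ≡ u ++ v × y ≡ run p u (v ++ q) × z ≡ run (p ++ u) v q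
  run-split []      z p w       q eq = [] , w , refl , refl ,
    trans eq (cong (λ p → run p w q) (sym (Listₚ.++-identityʳ p)))
  run-split (b ∷ y) z p (a ∷ w) q eq with Listₚ.∷-injective eq
  ... | b≡ , eq′ with run-split y z (p ∷ʳ a) w q eq′
  ... | u , v , refl , y≡ , z≡ = a ∷ u , v , refl ,
    cong₂ _∷_ (trans b≡ (cong (λ z → out ⟦ p ⟧ a ⟦ z ⟧) (Listₚ.++-assoc u v q))) y≡ ,
    trans z≡ (cong (λ p → run p v q) (Listₚ.++-assoc p [ a ] u))

-- Context-free grammars for inverse images of groupoid languages

Evals-nonempty : ∀ {t} {op : Op t} {w x} → Evals op w x → w ≢ []
Evals-nonempty (split {u} {v} d e) eq = Evals-nonempty d (Listₚ.++-conicalˡ u v eq)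

module InverseImage {g : ℕ} (op : Op (suc g)) (S : Subset (suc g)) (B : Bimachine k (suc g)) where
  open Bimachine B
  open BimachineProperties B

  -- The nonterminal (l , r , s , x) generates the words w with value s such
  -- that, between contexts of values l and r, the output on w evaluates to x.
  Nonterminal : Set
  Nonterminal = ⊤ ⊎ (Carrier × Carrier × Carrier × Fin (suc g))

  Nonterminal-finite : Finite Nonterminal
  Nonterminal-finite = Finite-⊎ Finite-⊤
    (Finite-× Carrier-finite (Finite-× Carrier-finite (Finite-× Carrier-finite Finite-Fin)))

  open Finite Nonterminal-finite using (size; enc; dec; dec-enc)

  Symbol : Set
  Symbol = Fin size ⊎ Fin k

  ⌜_⌝ : Nonterminal → Symbol
  ⌜ N ⌝ = inj₁ (enc N)

  StartData LeafData NodeData : Set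
  StartData = Carrier × Fin (suc g)
  LeafData  = Carrier × Fin k × Carrier
  NodeData  = Carrier × Carrier × Carrier × Carrier × Fin (suc g) × Fin (suc g)

  StartData-finite : Finite StartData
  StartData-finite = Finite-× Carrier-finite Finite-Fin

  LeafData-finite : Finite LeafData
  LeafData-finite = Finite-× Carrier-finite (Finite-× Finite-Fin Carrier-finite)

  NodeData-finite : Finite NodeData
  NodeData-finite = Finite-× Carrier-finite (Finite-× Carrier-finite
    (Finite-× Carrier-finite (Finite-× Carrier-finite (Finite-× Finite-Fin Finite-Fin))))

  startRule : StartData → Fin size × List Symbol
  startRule (s , x) = enc (inj₁ tt) , ⌜ inj₂ (⟦ [] ⟧ , ⟦ [] ⟧ , s , x) ⌝ ∷ []

  leafRule : LeafData → Fin size × List Symbol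
  leafRule (l , a , r) = enc (inj₂ (l , r , ⟦ [ a ] ⟧ , out l a r)) , inj₂ a ∷ []

  nodeRule : NodeData → Fin size × List Symbol
  nodeRule (l , r , s , s′ , x , y) = enc (inj₂ (l , r , s · s′ , op x y)) ,
    -- Each child has its sibling as part of its context: the right one extends `r`, the left one
    -- extends `l`.
    ⌜ inj₂ (l , s′ · r , s , x) ⌝ ∷ ⌜ inj₂ (l · s , r , s′ , y) ⌝ ∷ []

  startRules leafRules nodeRules : List (Fin size × List Symbol)
  startRules = List.map startRule (List.filter (λ d → proj₂ d ∈? S) (Finite.elements StartData-finite))
  leafRules  = List.map leafRule (Finite.elements LeafData-finite)
  nodeRules  = List.map nodeRule (Finite.elements NodeData-finite)

  grammar : CFG k
  grammar = record { m = size ; start = enc (inj₁ tt) ; rules = startRules ++ leafRules ++ nodeRules }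

  -- An inductive view of the rule list, on which the soundness proof can match.
  data Rule : Fin size × List Symbol → Set where
    start : ∀ d → proj₂ d ∈ S → Rule (startRule d)
    leaf  : ∀ d → Rule (leafRule d)
    node  : ∀ d → Rule (nodeRule d)

  Rule⇒∈ : ∀ {r} → Rule r → r ∈ₗ CFG.rules grammar
  Rule⇒∈ (start d x∈S) = ∈-++⁺ˡ (∈-map⁺ startRule (∈-filter⁺ (λ d → proj₂ d ∈? S) (Finite.∈-elements StartData-finite d) x∈S))
  Rule⇒∈ (leaf d)      = ∈-++⁺ʳ startRules (∈-++⁺ˡ (∈-map⁺ leafRule (Finite.∈-elements LeafData-finite d)))
  Rule⇒∈ (node d)      = ∈-++⁺ʳ startRules (∈-++⁺ʳ leafRules (∈-map⁺ nodeRule (Finite.∈-elements NodeData-finite d)))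

  ∈⇒Rule : ∀ {r} → r ∈ₗ CFG.rules grammar → Rule r
  ∈⇒Rule r∈ = [ fromStart , [ fromLeaf , fromNode ]′ ∘ ∈-++⁻ leafRules ]′ (∈-++⁻ startRules r∈)
    where
    fromStart : ∀ {r} → r ∈ₗ startRules → Rule r
    fromStart r∈ with ∈-map⁻ startRule r∈
    ... | d , d∈ , refl = start d (proj₂ (∈-filter⁻ (λ d → proj₂ d ∈? S) {xs = Finite.elements StartData-finite} d∈))
    fromLeaf : ∀ {r} → r ∈ₗ leafRules → Rule r
    fromLeaf r∈ with ∈-map⁻ leafRule r∈
    ... | d , _ , refl = leaf d
    fromNode : ∀ {r} → r ∈ₗ nodeRules → Rule r
    fromNode r∈ with ∈-map⁻ nodeRule r∈
    ... | d , _ , refl = node d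

  -- The claim ranges over all contexts with values `l` and `r`, so its second half is vacuous if no
  -- word has one of these values. The start rules use `⟦ [] ⟧`, which the empty contexts realise.
  Meaning : Nonterminal → Lang k
  Meaning (inj₁ tt)                w = W op S (run [] w [])
  Meaning (inj₂ (l , r , s , x)) w =
    ⟦ w ⟧ ≡ s × (∀ p q → ⟦ p ⟧ ≡ l → ⟦ q ⟧ ≡ r → Evals op (run p w q) x)

  leaf-meaning : ∀ l a r → Meaning (inj₂ (l , r , ⟦ [ a ] ⟧ , out l a r)) [ a ]
  leaf-meaning l a r = refl , λ { p q refl refl → single _ }

  node-meaning : ∀ {l r s s′ x y} u v →
    Meaning (inj₂ (l , s′ · r , s , x)) u → Meaning (inj₂ (l · s , r , s′ , y)) v →
    Meaning (inj₂ (l , r , s · s′ , op x y)) (u ++ v)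
  node-meaning u v (refl , f) (refl , h) = ⟦⟧-++ u v , λ { p q refl refl →
    subst (λ z → Evals op z _) (sym (run-++ p u v q))
      (split (f p (v ++ q) refl (⟦⟧-++ v q)) (h (p ++ u) q (⟦⟧-++ p u) refl)) }

  mutual
    sound-enc : ∀ {A w} → Derives grammar (inj₁ A) w → Meaning (dec A) w
    sound-enc (rule r∈ ds) = sound-rule (∈⇒Rule r∈) ds

    sound-rule : ∀ {A rhs w} → Rule (A , rhs) → DerivesList grammar rhs w → Meaning (dec A) w
    sound-rule (start (s , x) x∈S) (_∷_ {u = u} d []) = decode (inj₁ tt) (x , x∈S ,
      subst (λ w → Evals op (run [] w []) x) (sym (Listₚ.++-identityʳ u))
        (proj₂ (sound (inj₂ (⟦ [] ⟧ , ⟦ [] ⟧ , s , x)) d) [] [] refl refl))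
    sound-rule (leaf (l , a , r)) (term _ ∷ []) =
      decode (inj₂ (l , r , ⟦ [ a ] ⟧ , out l a r)) (leaf-meaning l a r)
    sound-rule (node (l , r , s , s′ , x , y)) (_∷_ {u = u} d (_∷_ {u = v} e [])) =
      decode (inj₂ (l , r , s · s′ , op x y)) (node-meaning u (v ++ [])
        (sound (inj₂ (l , s′ · r , s , x)) d)
        (subst (Meaning (inj₂ (l · s , r , s′ , y))) (sym (Listₚ.++-identityʳ v)) (sound (inj₂ (l · s , r , s′ , y)) e)))

    sound : ∀ N {w} → Derives grammar ⌜ N ⌝ w → Meaning N w
    sound N {w} d = subst (λ N → Meaning N w) (dec-enc N) (sound-enc d)

    decode : ∀ N {w} → Meaning N w → Meaning (dec (enc N)) w
    decode N {w} = subst (λ N → Meaning N w) (sym (dec-enc N))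

  -- Induction on the bracketing of the output; the annotations are the actual values of the factor
  -- and its contexts, and `run-split` supplies the factors for the children.
  complete : ∀ {z x} → Evals op z x → ∀ p w q → z ≡ run p w q →
    Derives grammar ⌜ inj₂ (⟦ p ⟧ , ⟦ q ⟧ , ⟦ w ⟧ , x) ⌝ w
  complete (single _) p (a ∷ []) q refl = rule (Rule⇒∈ (leaf (⟦ p ⟧ , a , ⟦ q ⟧))) (term a ∷ [])
  complete (split {y} {z} {x} {x′} d e) p w q eq with run-split y z p w q eq
  ... | u , v , refl , y≡ , z≡ =
    subst₂ (λ s w → Derives grammar ⌜ inj₂ (⟦ p ⟧ , ⟦ q ⟧ , s , op x x′) ⌝ w)
      (sym (⟦⟧-++ u v)) (cong (u ++_) (Listₚ.++-identityʳ v))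
      (rule (Rule⇒∈ (node (⟦ p ⟧ , ⟦ q ⟧ , ⟦ u ⟧ , ⟦ v ⟧ , x , x′)))
        (subst (λ r → Derives grammar ⌜ inj₂ (⟦ p ⟧ , r , ⟦ u ⟧ , x) ⌝ u) (⟦⟧-++ v q) (complete d p u (v ++ q) y≡) ∷
         subst (λ l → Derives grammar ⌜ inj₂ (l , ⟦ q ⟧ , ⟦ v ⟧ , x′) ⌝ v) (⟦⟧-++ p u) (complete e (p ++ u) v q z≡) ∷
         []))

  generates : ∀ w → W op S (run [] w []) ⇔ Generates grammar w
  generates w = mk⇔
    (λ (x , x∈S , d) → subst (Generates grammar) (Listₚ.++-identityʳ w)
      (rule (Rule⇒∈ (start (⟦ w ⟧ , x) x∈S)) (complete d [] w [] refl ∷ [])))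
    (sound (inj₁ tt))

-- Definable languages are context-free

QLang-run : ∀ {g} (op : Op (suc g)) (S : Subset (suc g)) (φs : Vec (Fml k 1) g) → ∀ w →
  QLang (W op S) φs w ⇔ W op S (Bimachine.run (induced-bimachine φs) [] w [])
-- `QLang` rejects the empty word by definition, and no bracketing evaluates the empty output.
QLang-run op S φs []       = mk⇔ (λ ()) λ (x , _ , d) → contradiction refl (Evals-nonempty d)
QLang-run {k = k} op S φs (a ∷ w) = mk⇔ (subst (W op S) eq) (subst (W op S) (sym eq))
  where
  eq : induced φs (Vec.fromList (a ∷ w)) ≡ Bimachine.run (induced-bimachine φs) [] (a ∷ w) []
  eq = trans (run-induced φs (Vec.fromList (a ∷ w)))
    (cong (λ w → Bimachine.run (induced-bimachine φs) [] w []) (Vecₚ.toList∘fromList (a ∷ w)))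

InQunFO⇒InCFL : ∀ {g} (op : Op (suc g)) (L : Lang k) → InQunFO op k L → InCFL k L
InQunFO⇒InCFL op L (S , φs , L⇔) =
  (InverseImage.grammar op S (induced-bimachine φs) ,
   λ w → ⇔-trans (L⇔ w) (⇔-trans (QLang-run op S φs w) (InverseImage.generates op S (induced-bimachine φs) w))) ,
  Equivalence.to (L⇔ [])

-- Even palindromes

module Palindromes (k : ℕ) where

  -- The recursion ends in `aa` instead of the empty word, which keeps the language free of the
  -- empty word.
  pairRule wrapRule : Fin k → Fin 1 × List (Fin 1 ⊎ Fin k)
  pairRule a = zero , inj₂ a ∷ inj₂ a ∷ []
  wrapRule a = zero , inj₂ a ∷ inj₁ zero ∷ inj₂ a ∷ []

  grammar : CFG k
  grammar = record { m = 1 ; start = zero ; rules = List.map pairRule (List.allFin k) ++ List.map wrapRule (List.allFin k) }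

  palindrome : ∀ {A w} → Derives grammar (inj₁ A) w → reverse w ≡ w
  palindrome (rule r∈ ds) with ∈-++⁻ (List.map pairRule (List.allFin k)) r∈
  palindrome (rule r∈ ds) | inj₁ r∈′ with ∈-map⁻ pairRule r∈′
  palindrome (rule r∈ (term a ∷ (term .a ∷ []))) | inj₁ r∈′ | .a , _ , refl = refl
  palindrome (rule r∈ ds) | inj₂ r∈′ with ∈-map⁻ wrapRule r∈′
  palindrome (rule r∈ (term a ∷ (_∷_ {u = u} d (term .a ∷ [])))) | inj₂ r∈′ | .a , _ , refl = begin
    reverse (a ∷ u ∷ʳ a)              ≡⟨ Listₚ.unfold-reverse a (u ∷ʳ a) ⟩
    reverse (u ∷ʳ a) ∷ʳ a             ≡⟨ cong (_∷ʳ a) (Listₚ.reverse-++ u [ a ]) ⟩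
    a ∷ reverse u ∷ʳ a                ≡⟨ cong (λ u → a ∷ u ∷ʳ a) (palindrome d) ⟩
    a ∷ u ∷ʳ a                        ∎

  nonempty : ∀ {A w} → Derives grammar (inj₁ A) w → w ≢ []
  nonempty (rule r∈ ds) eq with ∈-++⁻ (List.map pairRule (List.allFin k)) r∈
  nonempty (rule r∈ ds) eq | inj₁ r∈′ with ∈-map⁻ pairRule r∈′
  nonempty (rule r∈ (term a ∷ ds)) () | inj₁ r∈′ | .a , _ , refl
  nonempty (rule r∈ ds) eq | inj₂ r∈′ with ∈-map⁻ wrapRule r∈′
  nonempty (rule r∈ (term a ∷ ds)) () | inj₂ r∈′ | .a , _ , refl

  inCFL : InCFL k (Generates grammar)
  inCFL = (grammar , λ w → mk⇔ id id) , λ d → nonempty d refl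

  doubled : (u : Vec (Fin k) (suc n)) → Generates grammar (Vec.toList u ++ reverse (Vec.toList u))
  doubled (a ∷ []) = rule (∈-++⁺ˡ (∈-map⁺ pairRule (∈-allFin a))) (term a ∷ (term a ∷ []))
  doubled (a ∷ u@(_ ∷ _)) = subst (Generates grammar)
    (cong (a ∷_) (begin
      (Vec.toList u ++ reverse (Vec.toList u)) ++ [ a ]    ≡⟨ Listₚ.++-assoc (Vec.toList u) _ [ a ] ⟩
      Vec.toList u ++ (reverse (Vec.toList u) ++ [ a ])    ≡⟨ cong (Vec.toList u ++_) (Listₚ.unfold-reverse a (Vec.toList u)) ⟨
      Vec.toList u ++ reverse (a ∷ Vec.toList u)           ∎))
    (rule (∈-++⁺ʳ (List.map pairRule (List.allFin k)) (∈-map⁺ wrapRule (∈-allFin a)))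
      (term a ∷ (doubled u ∷ (term a ∷ []))))

  -- Reversing the palindrome turns `u` followed by the mirror of `v` into `v` followed by the
  -- mirror of `u`; equal lengths allow comparing the first halves.
  mirror-unique : (u v : Vec (Fin k) n) → Generates grammar (Vec.toList u ++ reverse (Vec.toList v)) → u ≡ v
  mirror-unique {n} u v d = toList-injective u v (proj₁ (++-injective (Vec.toList u) (Vec.toList v)
    (trans (Vecₚ.length-toList u) (sym (Vecₚ.length-toList v))) (begin
      Vec.toList u ++ reverse (Vec.toList v)                        ≡⟨ palindrome d ⟨
      reverse (Vec.toList u ++ reverse (Vec.toList v))              ≡⟨ Listₚ.reverse-++ (Vec.toList u) _ ⟩
      reverse (reverse (Vec.toList v)) ++ reverse (Vec.toList u)    ≡⟨ cong (_++ _) (Listₚ.reverse-involutive (Vec.toList v)) ⟩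
      Vec.toList v ++ reverse (Vec.toList u)                        ∎)))
    where
    ++-injective : ∀ (xs ys : List A) {zs ws} → List.length xs ≡ List.length ys → xs ++ zs ≡ ys ++ ws → xs ≡ ys × zs ≡ ws
    ++-injective []       []       len eq = refl , eq
    ++-injective (x ∷ xs) (y ∷ ys) len eq with Listₚ.∷-injective eq
    ... | refl , eq′ with ++-injective xs ys (suc-injective len) eq′
    ... | refl , zs≡ = refl , zs≡
    toList-injective : ∀ {n} (u v : Vec A n) → Vec.toList u ≡ Vec.toList v → u ≡ v
    toList-injective u v eq = trans (sym (Vecₚ.cast-is-id refl u)) (Vecₚ.toList-injective refl u v eq)

-- Counting words against profiles

n<2^n : ∀ n → n < 2 ^ n
n<2^n zero    = s≤s z≤n
n<2^n (suc n) = ≤-trans (+-mono-≤ (m^n>0 2 n) (n<2^n n)) (≤-reflexive (cong (2 ^ n +_) (sym (+-identityʳ (2 ^ n)))))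

-- With an alphabet twice as large as the output alphabet, the inputs of length `n` outnumber the
-- outputs by the factor `2 ^ n`, which exceeds `c` at `n = suc c`.
many-words : ∀ c t .{{_ : NonZero t}} → c * t ^ suc c < (2 * t) ^ suc c
many-words c t = subst (c * t ^ suc c <_) (^-distribʳ-* (suc c))
  (*-monoˡ-< (t ^ suc c) {{m^n≢0 t (suc c)}} (<-trans (n<1+n c) (n<2^n (suc c))))
  where
  ^-distribʳ-* : ∀ n → 2 ^ n * t ^ n ≡ (2 * t) ^ n
  ^-distribʳ-* zero    = refl
  ^-distribʳ-* (suc n) = trans ([m*n]*[o*p]≡[m*o]*[n*p] 2 (2 ^ n) t (t ^ n)) (cong (2 * t *_) (^-distribʳ-* n))

-- Words outnumber profiles, so two distinct words u and v share a profile;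
-- then uuᴿ and vuᴿ have the same output, but only the first is a palindrome.
module Fooling {t : ℕ} {{_ : NonZero t}} (B : Bimachine (2 * t) t) where
  open Bimachine B
  open BimachineProperties B

  Values-finite : Finite (Carrier × Carrier)
  Values-finite = Finite-× Carrier-finite Carrier-finite

  len : ℕ
  len = suc (Finite.size Values-finite)

  Word : Set
  Word = Vec (Fin (2 * t)) len

  Word-finite : Finite Word
  Word-finite = Finite-Vec Finite-Fin len

  length-run : ∀ p w q → List.length (run p w q) ≡ List.length w
  length-run p []      q = refl
  length-run p (a ∷ w) q = cong suc (length-run (p ∷ʳ a) w q)

  output : Word → Vec (Fin t) len
  output u = Vec.cast (trans (length-run [] w (reverse w)) (Vecₚ.length-toList u)) (Vec.fromList (run [] w (reverse w)))
    where w = Vec.toList u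

  toList-output : ∀ u → Vec.toList (output u) ≡ run [] (Vec.toList u) (reverse (Vec.toList u))
  toList-output u = trans (Vecₚ.toList-cast _ _) (Vecₚ.toList∘fromList _)

  Profile : Set
  Profile = (Carrier × Carrier) × Vec (Fin t) len

  Profile-finite : Finite Profile
  Profile-finite = Finite-× Values-finite (Finite-Vec Finite-Fin len)

  -- The value of `u` is what the second half of the doubled word sees to its left, the value of its
  -- mirror what the first half sees to its right.
  profile : Word → Profile
  profile u = (⟦ Vec.toList u ⟧ , ⟦ reverse (Vec.toList u) ⟧) , output u

  collision : Σ Word λ u → Σ Word λ v → u ≢ v × profile u ≡ profile v
  -- The sizes of the codings of `Profile` and `Word` are by computation the two sides of
  -- `many-words`; `len` was chosen for this.
  collision with Finₚ.pigeonhole (many-words (Finite.size Values-finite) t)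
                   (Finite.enc Profile-finite ∘ profile ∘ Finite.dec Word-finite)
  ... | i , j , i<j , eq = W.dec i , W.dec j ,
    (λ u≡v → Finₚ.<⇒≢ i<j (trans (sym (W.enc-dec i)) (trans (cong W.enc u≡v) (W.enc-dec j)))) ,
    trans (sym (P.dec-enc _)) (trans (cong P.dec eq) (P.dec-enc _))
    where module W = Finite Word-finite
          module P = Finite Profile-finite

  exchange : ∀ u v → profile u ≡ profile v →
    run [] (Vec.toList u ++ reverse (Vec.toList u)) [] ≡ run [] (Vec.toList v ++ reverse (Vec.toList u)) []
  exchange u v eq = begin
    run [] (x ++ reverse x) []                            ≡⟨ run-++ [] x (reverse x) [] ⟩
    run [] x (reverse x ++ []) ++ run x (reverse x) []    ≡⟨ cong₂ _++_ left (run-cong (reverse x) (cong (proj₁ ∘ proj₁) eq) refl) ⟩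
    run [] y (reverse x ++ []) ++ run y (reverse x) []    ≡⟨ run-++ [] y (reverse x) [] ⟨
    run [] (y ++ reverse x) []                            ∎
    where
    x y : List (Fin (2 * t))
    x = Vec.toList u
    y = Vec.toList v
    left : run [] x (reverse x ++ []) ≡ run [] y (reverse x ++ [])
    -- The detour goes through `y` followed by its own mirror: equal profiles give equal outputs
    -- there, and equal values of the mirrors then allow `reverse x` back as the context.
    left = begin
      run [] x (reverse x ++ [])    ≡⟨ cong (run [] x) (Listₚ.++-identityʳ (reverse x)) ⟩
      run [] x (reverse x)          ≡⟨ toList-output u ⟨
      Vec.toList (output u)         ≡⟨ cong (Vec.toList ∘ proj₂) eq ⟩
      Vec.toList (output v)         ≡⟨ toList-output v ⟩
      run [] y (reverse y)          ≡⟨ run-cong y refl (cong (proj₂ ∘ proj₁) eq) ⟨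
      run [] y (reverse x)          ≡⟨ cong (run [] y) (Listₚ.++-identityʳ (reverse x)) ⟨
      run [] y (reverse x ++ [])    ∎

  palindromes-not-inverse-image : (X : Lang t) →
    ¬ (∀ w → Generates (Palindromes.grammar (2 * t)) w ⇔ X (run [] w []))
  palindromes-not-inverse-image X L⇔ = fooled collision
    where
    open Palindromes (2 * t) using (mirror-unique; doubled)
    fooled : ¬ (Σ Word λ u → Σ Word λ v → u ≢ v × profile u ≡ profile v)
    fooled (u , v , u≢v , eq) = u≢v (sym (mirror-unique v u (Equivalence.from (L⇔ _)
      (subst X (exchange u v eq) (Equivalence.to (L⇔ _) (doubled u))))))

-- Even palindromes separate the two classes

palindromes-∉-QunFO : ∀ {g} (op : Op (suc g)) →
  ¬ InQunFO op (2 * suc g) (Generates (Palindromes.grammar (2 * suc g)))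
palindromes-∉-QunFO op (S , φs , L⇔) = Fooling.palindromes-not-inverse-image (induced-bimachine φs) (W op S)
  λ w → ⇔-trans (L⇔ w) (QLang-run op S φs w)

theorem19 : (g : ℕ) (op : Op (suc g)) →
    ((k : ℕ) (L : Lang k) → InQunFO op k L → InCFL k L)
    × Σ ℕ (λ k → Σ (Lang k) (λ L → InCFL k L × ¬ InQunFO op k L))
theorem19 g op =
  (λ k → InQunFO⇒InCFL op) ,
  2 * suc g , Generates (Palindromes.grammar (2 * suc g)) , Palindromes.inCFL (2 * suc g) , palindromes-∉-QunFO op
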